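{- For every message $M$ and formula $\phi$: $\vdash\mathsf{k}_{\mathsf{CM}}(M)\to\phi$ if and only if $\vdash[M]\phi$.
   Context: Fix a finite set $\mathcal{A}$ of agent names containing a distinguished name $\mathsf{CM}$. Messages: $M ::= a \mid B \mid (M,M)$ ($a\in\mathcal{A}$, $B$ optional data constants, pairs). $\mathcal{P}$ is a denumerable set of propositional variables containing atoms $\mathsf{k}_a(M)$ ("$a$ knows $M$"). Formulas: $\phi ::= P \mid \phi\wedge\phi \mid \phi\vee\phi \mid \neg\phi \mid \phi\to\phi \mid [M]\phi$. Abbreviations: $\mathrm{true}:=\mathsf{k}_{\mathsf{CM}}(\mathsf{CM})$, $\mathrm{false}:=\neg\mathrm{true}$, $\phi\leftrightarrow\psi:=(\phi\to\psi)\wedge(\psi\to\phi)$, $\langle M\rangle\phi:=\neg\neg(\mathsf{k}_{\mathsf{CM}}(M)\wedge\phi)$. LIiP is the smallest set of formulas containing all instances of: the axioms of an adequate Hilbert axiomatization of intuitionistic propositional logic; $\mathsf{k}_a(a)$; $(\mathsf{k}_a(M)\wedge\mathsf{k}_a(M'))\leftrightarrow\mathsf{k}_a((M,M'))$; $[M]\mathsf{k}_{\mathsf{CM}}(M)$; $[M](\phi\to\psi)\to([M]\phi\to[M]\psi)$; $[M]\phi\to(\mathsf{k}_{\mathsf{CM}}(M)\to\phi)$; $[M]\phi\to\langle M\rangle\phi$; $\phi\to[M]\phi$; and closed under modus ponens and the rule: if $\mathsf{k}_{\mathsf{CM}}(M)\to\mathsf{k}_{\mathsf{CM}}(M')$ is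 in the set then so is $[M']\phi\to[M]\phi$ for every $\phi$. Write $\vdash\phi$ for $\phi\in\mathrm{LIiP}$. -}

module Defs where

open import Data.Nat using (ℕ)
open import Data.Fin using (Fin)
open import Data.Product using (_×_; _,_; ∃-syntax)
open import Function.Bundles using (_↔_; _↣_; module Injection)

data Message (Agent Data : Set) : Set where
  agent : Agent → Message Agent Data
  datum : Data → Message Agent Data
  pair  : Message Agent Data → Message Agent Data → Message Agent Data

-- `Data` may be empty, since data constants are optional.  `Var` is the whole
-- denumerable set 𝒫 of propositional variables; `atom` singles out in it
-- pairwise distinct variables k_a(M), and there may be further variables.
record Language : Set₁ where
  field
    Agent       : Set
    finite      : ∃[ n ] (Agent ↔ Fin n)
    CM          : Agent
    Data        : Set
    Var         : Set
    denumerable : Var ↔ ℕ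
    atom        : (Agent × Message Agent Data) ↣ Var

open Language public

Msg : Language → Set
Msg L = Message (Agent L) (Data L)

infixr 9 [_]_ ⟨_⟩_
infix  9 ∼_
infixr 7 _∧_
infixr 6 _∨_
infixr 5 _⊃_
infix  4 _⊃⊂_

-- Negation is a primitive connective, not φ ⊃ false.
data Formula (L : Language) : Set where
  var         : Var L → Formula L
  _∧_ _∨_ _⊃_ : Formula L → Formula L → Formula L
  ∼_          : Formula L → Formula L
  [_]_        : Msg L → Formula L → Formula L

k : {L : Language} → Agent L → Msg L → Formula L
k {L} a M = var (Injection.to (atom L) (a , M))

_⊃⊂_ : {L : Language} → Formula L → Formula L → Formula L
φ ⊃⊂ ψ = (φ ⊃ ψ) ∧ (ψ ⊃ φ)

⟨_⟩_ : {L : Language} → Msg L → Formula L → Formula L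
⟨_⟩_ {L} M φ = ∼ (∼ (k (CM L) M ∧ φ))

-- Kleene's axiom schemes for intuitionistic propositional logic with primitive
-- negation; φ, ψ, χ range over all formulas, including those of the form [ M ] φ.
data IPCAxiom {L : Language} : Formula L → Set where
  ax-K  : ∀ φ ψ   → IPCAxiom (φ ⊃ (ψ ⊃ φ))
  ax-S  : ∀ φ ψ χ → IPCAxiom ((φ ⊃ (ψ ⊃ χ)) ⊃ ((φ ⊃ ψ) ⊃ (φ ⊃ χ)))
  ax-∧I : ∀ φ ψ   → IPCAxiom (φ ⊃ (ψ ⊃ (φ ∧ ψ)))
  ax-∧₁ : ∀ φ ψ   → IPCAxiom ((φ ∧ ψ) ⊃ φ)
  ax-∧₂ : ∀ φ ψ   → IPCAxiom ((φ ∧ ψ) ⊃ ψ)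
  ax-∨₁ : ∀ φ ψ   → IPCAxiom (φ ⊃ (φ ∨ ψ))
  ax-∨₂ : ∀ φ ψ   → IPCAxiom (ψ ⊃ (φ ∨ ψ))
  ax-∨E : ∀ φ ψ χ → IPCAxiom ((φ ⊃ χ) ⊃ ((ψ ⊃ χ) ⊃ ((φ ∨ ψ) ⊃ χ)))
  ax-∼I : ∀ φ ψ   → IPCAxiom ((φ ⊃ ψ) ⊃ ((φ ⊃ ∼ ψ) ⊃ ∼ φ))
  ax-∼E : ∀ φ ψ   → IPCAxiom (∼ φ ⊃ (φ ⊃ ψ))

infix 3 ⊢_

-- ⊢ φ means φ ∈ LIiP; smallness of the set is the inductive reading.
data ⊢_ {L : Language} : Formula L → Set where
  ipc       : ∀ {φ} → IPCAxiom φ → ⊢ φ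
  self-name : (a : Agent L) → ⊢ k {L} a (agent a)
  pairing   : (a : Agent L) (M M′ : Msg L) → ⊢ (k {L} a M ∧ k a M′) ⊃⊂ k {L} a (pair M M′)
  self-know : (M : Msg L) → ⊢ [ M ] k {L} (CM L) M
  dist      : (M : Msg L) (φ ψ : Formula L) → ⊢ [ M ] (φ ⊃ ψ) ⊃ ([ M ] φ ⊃ [ M ] ψ)
  truth     : (M : Msg L) (φ : Formula L) → ⊢ [ M ] φ ⊃ (k (CM L) M ⊃ φ)
  consist   : (M : Msg L) (φ : Formula L) → ⊢ [ M ] φ ⊃ ⟨ M ⟩ φ
  persist   : (M : Msg L) (φ : Formula L) → ⊢ φ ⊃ [ M ] φ
  mp        : {φ ψ : Formula L} → ⊢ φ ⊃ ψ → ⊢ φ → ⊢ ψ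
  antitone  : {M M′ : Msg L} (φ : Formula L) →
              ⊢ k {L} (CM L) M ⊃ k {L} (CM L) M′ → ⊢ [ M′ ] φ ⊃ [ M ] φ

{-# OPTIONS --safe #-}
module Submission where

open import Defs
open import Function.Bundles using (_⇔_; mk⇔)

theorem2p27 : (L : Language) (M : Msg L) (φ : Formula L) →
    (⊢ (k (CM L) M ⊃ φ)) ⇔ (⊢ ([ M ] φ))
theorem2p27 L M φ = mk⇔
  -- `persist` serves as necessitation, applied to the whole implication because `φ` alone need not
  -- be provable. Distributing `[ M ]` over it leaves the boxed premise `[ M ] k (CM L) M`, which is
  -- exactly `self-know`.
  (λ kM⊃φ → mp (mp (dist M (k (CM L) M) φ) (mp (persist M (k (CM L) M ⊃ φ)) kM⊃φ)) (self-know M))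
  -- The converse is one instance of `truth`: what `M` proves holds once `CM` knows `M`.
  (mp (truth M φ))
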